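{- An isolate-free graph $G$ is $\gamma_{tg}'$-perfect if and only if it is a cograph.
   Context: Graphs are finite, simple, undirected, with at least one vertex, not necessarily connected. A cograph is a graph containing no induced path $P_4$ on four vertices. A graph is isolate-free if it has no vertex of degree $0$. A vertex totally dominates its neighbors (not itself). For an isolate-free graph $G$, $\gamma_t(G)$ is the total domination number, i.e. the minimum size of a set $S\subseteq V(G)$ such that every vertex of $G$ has a neighbor in $S$. Total domination game on an isolate-free graph $G$: Dominator and Staller alternately select vertices; each selected vertex must totally dominate at least one vertex not totally dominated by the previously selected vertices. The game ends when no legal move exists. Dominator wants to minimize and Staller to maximize the total number of moves. $\gamma_{tg}'(G)$ is the number of moves under optimal play when Staller starts. $G$ is $\gamma_{tg}'$-perfect if every isolate-free induced subgraph $F$ of $G$ satisfies $\gamma_{tg}'(F)=\gamma_t(F)$. -}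

module Defs where

open import Data.Bool.Base using (true; false)
open import Data.Fin.Base using (Fin; toℕ)
open import Data.Fin.Properties using (any?; all?)
open import Data.Fin.Subset
  using (Subset; _∈_; _∉_; _∪_; ⁅_⁆; ∣_∣) renaming (⊥ to ∅)
open import Data.Fin.Subset.Properties
  using (_∈?_; ∈⊤; ∣p∣≤n; ∣p∣≡n⇒p≡⊤; p⊂q⇒∣p∣<∣q∣; p⊆p∪q; x∈p∪q⁺; x∈⁅x⁆)
open import Data.List.Base
  using (List; []; _∷_; [_]; _++_; map; filter; allFin)
open import Data.List.Extrema.Nat using (min; max)
open import Data.List.Properties using (map-cong-local)
open import Data.List.Relation.Unary.All as All using (All; []; _∷_)
open import Data.List.Relation.Unary.All.Properties using (all-filter)
open import Data.Nat.Base using (ℕ; zero; suc; _+_; _≤_; NonZero)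
open import Data.Nat.Properties
  using (_≟_; 1+n≢n; ≤-antisym; ≤-trans; ≤-reflexive; +-suc; +-monoʳ-≤)
open import Data.Product.Base using (∃-syntax; _×_; _,_)
open import Data.Sum.Base using (_⊎_; inj₁; inj₂; swap)
import Data.Vec.Base as Vec
open import Function.Bundles using (_⇔_)
open import Function.Definitions using (Injective)
open import Level using (0ℓ)
open import Relation.Binary.Core using (Rel)
open import Relation.Binary.Definitions
  using (Decidable; Symmetric; Irreflexive)
open import Relation.Binary.PropositionalEquality.Core
  using (_≡_; refl; sym; subst; cong; cong₂)
open import Relation.Nullary.Decidable using (Dec; _×-dec_; _⊎-dec_; ¬?)
open import Relation.Nullary.Negation.Core using (¬_; contradiction)

record Graph : Set₁ where
  field
    order    : ℕ
    nonEmpty : NonZero order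

  Vertex : Set
  Vertex = Fin order

  field
    Adj    : Rel Vertex 0ℓ
    Adj?   : Decidable Adj
    symm   : Symmetric Adj
    irrefl : Irreflexive _≡_ Adj

-- F is isomorphic to the subgraph of G induced by some set of vertices.
record _≤ᵢ_ (F G : Graph) : Set where
  private
    module F = Graph F
    module G = Graph G
  field
    embed     : F.Vertex → G.Vertex
    injective : Injective _≡_ _≡_ embed
    induced   : ∀ {u v} → F.Adj u v ⇔ G.Adj (embed u) (embed v)

path : (n : ℕ) → {{NonZero n}} → Graph
path n {{n≢0}} = record
  { order    = n
  ; nonEmpty = n≢0
  ; Adj      = λ i j → toℕ j ≡ suc (toℕ i) ⊎ toℕ i ≡ suc (toℕ j)
  ; Adj?     = λ i j → (toℕ j ≟ suc (toℕ i)) ⊎-dec (toℕ i ≟ suc (toℕ j))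
  ; symm     = swap
  ; irrefl   = λ { refl (inj₁ e) → 1+n≢n (sym e)
                 ; refl (inj₂ e) → 1+n≢n (sym e) }
  }

Cograph : Graph → Set
Cograph G = ¬ (path 4 ≤ᵢ G)

-- Every subset occurs exactly once.
subsets : ∀ n → List (Subset n)
subsets zero    = [ Vec.[] ]
subsets (suc n) =
  map (true Vec.∷_) (subsets n) ++ map (false Vec.∷_) (subsets n)

data Player : Set where
  dominator staller : Player

opponent : Player → Player
opponent dominator = staller
opponent staller   = dominator

-- best p x xs is the value that p prefers in the nonempty list x ∷ xs.
best : Player → ℕ → List ℕ → ℕ
best dominator = min
best staller   = max

-- The number of remaining moves when p must choose from the given list of
-- legal moves and choosing v leads to after v further moves.
optimum : {A : Set} → Player → (A → ℕ) → List A → ℕ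
optimum p after []       = 0
optimum p after (v ∷ vs) = suc (best p (after v) (map after vs))

module _ (G : Graph) where
  open Graph G

  IsolateFree : Set
  IsolateFree = ∀ v → ∃[ w ] Adj v w

  TotallyDominated : Subset order → Vertex → Set
  TotallyDominated S u = ∃[ w ] (w ∈ S × Adj w u)

  totallyDominated? : ∀ S u → Dec (TotallyDominated S u)
  totallyDominated? S u = any? λ w → (w ∈? S) ×-dec Adj? w u

  TotalDominatingSet : Subset order → Set
  TotalDominatingSet S = ∀ u → TotallyDominated S u

  totalDominatingSet? : ∀ S → Dec (TotalDominatingSet S)
  totalDominatingSet? S = all? (totallyDominated? S)

  -- In an isolate-free graph the full vertex set is total dominating, so
  -- including `order` does not affect the minimum.
  γₜ : ℕ
  γₜ = min order (map ∣_∣ (filter totalDominatingSet? (subsets order)))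

  -- A position of the game is the set S of vertices selected so far.
  LegalMove : Subset order → Vertex → Set
  LegalMove S v = ∃[ u ] (Adj v u × ¬ TotallyDominated S u)

  legalMove? : ∀ S v → Dec (LegalMove S v)
  legalMove? S v = any? λ u → Adj? v u ×-dec ¬? (totallyDominated? S u)

  legalMoves : Subset order → List Vertex
  legalMoves S = filter (legalMove? S) (allFin order)

  -- The number of further moves under optimal play from position S with p to
  -- move, for the game cut off after k moves.
  movesWithin : ℕ → Player → Subset order → ℕ
  movesWithin zero    p S = 0
  movesWithin (suc k) p S =
    optimum p (λ v → movesWithin k (opponent p) (S ∪ ⁅ v ⁆)) (legalMoves S)

  -- No vertex is selected twice, so every play ends within `order` moves and
  -- the cut-off has no effect: see movesWithin-stable.
  γₜg′ : ℕ
  γₜg′ = movesWithin order staller ∅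

  private
    legal⇒∉ : ∀ {S v} → LegalMove S v → v ∉ S
    legal⇒∉ (u , v~u , ¬dom) v∈S = ¬dom (_ , v∈S , v~u)

    optimum-cong : ∀ {A : Set} p {f g : A → ℕ} {vs} →
                   All (λ v → f v ≡ g v) vs → optimum p f vs ≡ optimum p g vs
    optimum-cong p []         = refl
    optimum-cong p (eq ∷ eqs) =
      cong suc (cong₂ (best p) eq (map-cong-local eqs))

  movesWithin-stable : ∀ k p S → order ≤ k + ∣ S ∣ →
                       movesWithin (suc k) p S ≡ movesWithin k p S
  movesWithin-stable zero p S full
    with legalMoves S | all-filter (legalMove? S) (allFin order)
  ... | []    | []        = refl
  ... | v ∷ _ | legal ∷ _ = contradiction
    (subst (v ∈_) (sym (∣p∣≡n⇒p≡⊤ (≤-antisym (∣p∣≤n S) full))) ∈⊤)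
    (legal⇒∉ legal)
  movesWithin-stable (suc k) p S bound = optimum-cong p
    (All.map step (all-filter (legalMove? S) (allFin order)))
    where
    step : ∀ {v} → LegalMove S v →
           movesWithin (suc k) (opponent p) (S ∪ ⁅ v ⁆) ≡
           movesWithin k (opponent p) (S ∪ ⁅ v ⁆)
    step {v} legal = movesWithin-stable k (opponent p) (S ∪ ⁅ v ⁆)
      (≤-trans bound
        (≤-trans (≤-reflexive (sym (+-suc k ∣ S ∣)))
          (+-monoʳ-≤ k (p⊂q⇒∣p∣<∣q∣
            ( p⊆p∪q ⁅ v ⁆
            , v , x∈p∪q⁺ (inj₂ (x∈⁅x⁆ v)) , legal⇒∉ legal)))))

γₜg′-Perfect : Graph → Set₁
γₜg′-Perfect G = ∀ F → F ≤ᵢ G → IsolateFree F → γₜg′ F ≡ γₜ F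

-- P₄ is isolate-free with γₜ(P₄) = 2 but γₜg′(P₄) = 3, so a γₜg′-perfect graph
-- has no induced P₄.  Conversely, the final set of every play is total
-- dominating, so γₜ ≤ γₜg′.  For γₜg′ ≤ γₜ in a cograph, Dominator keeps the
-- set of totally dominated vertices a union of components: whenever Staller
-- selects v, Dominator answers with a neighbour v′ of v such that v and v′
-- together totally dominate the component of v.  Such a v′ exists because, in
-- the absence of induced P₄s, the sets N(w) ∖ N(v) for neighbours w of v form a
-- chain, so v′ can be chosen with the largest one.  Each round takes two moves,
-- while every total dominating set has at least two vertices in that component.
{-# OPTIONS --safe #-}
module Submission where

open import Defs
open import Data.Bool.Base using (true; false)
open import Data.Fin.Base using (zero; suc)
open import Data.Fin.Properties using (_≟_; all?; any?; ¬∀⟶∃¬)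
open import Data.Fin.Subset
  using (Subset; _∈_; _∪_; _-_; ⁅_⁆; ∣_∣; ⊤) renaming (⊥ to ∅)
open import Data.Fin.Subset.Properties
  using (p⊆p∪q; x∈p∪q⁺; x∈p∪q⁻; x∈⁅x⁆; x∈⁅y⁆⇒x≡y; ∪-identityʳ; ∉⊥; ∈⊤;
         ∣⊥∣≡0; ∣p∣≤n; p⊂q⇒∣p∣<∣q∣; x∈p⇒∣p-x∣<∣p∣; x∈p∧x≢y⇒x∈p-y)
open import Data.List.Base using (List; []; _∷_; map; filter; allFin)
open import Data.List.Extrema.Nat
  using (min≤v⁺; min≤⊤; min≤xs; v≤min⁺; max≤v⁺; argmin-sel; argmax-sel)
open import Data.List.Membership.Propositional using (lose)
  renaming (_∈_ to _∈ˡ_)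
open import Data.List.Membership.Propositional.Properties
  using (∈-map⁺; ∈-map⁻; ∈-filter⁺; ∈-allFin; ∈-++⁺ˡ; ∈-++⁺ʳ)
open import Data.List.Relation.Unary.All as All using (All; []; _∷_)
import Data.List.Relation.Unary.All.Properties as All
open import Data.List.Relation.Unary.Any using (here; there)
open import Data.Nat.Base using (ℕ; zero; suc; _+_; _≤_; _<_; z≤n; s≤s)
open import Data.Nat.Properties
  using (≤-refl; ≤-reflexive; ≤-trans; ≤-antisym; n≤1+n; +-suc; +-identityʳ;
         +-monoʳ-≤; +-monoˡ-≤; m≤m+n; module ≤-Reasoning)
open import Data.Product.Base using (∃-syntax; _×_; _,_)
open import Data.Sum.Base using (_⊎_; inj₁; inj₂; [_,_]′)
open import Data.Vec.Base using ([]; _∷_; lookup)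
open import Function.Base using (_∘_; const; id)
open import Function.Bundles using (_⇔_; mk⇔; Equivalence)
open import Relation.Binary.PropositionalEquality.Core
  using (_≡_; _≢_; refl; sym; cong; subst)
open import Relation.Nullary.Decidable
  using (Dec; yes; no; does; proof; _→-dec_; _⊎-dec_; decidable-stable; from-yes)
open import Relation.Nullary.Negation.Core using (¬_; contradiction)
open import Relation.Nullary.Reflects using (Reflects; ofʸ; ofⁿ)

-- Induced subgraphs and the path on four vertices.

≤ᵢ-trans : ∀ {E F G} → E ≤ᵢ F → F ≤ᵢ G → E ≤ᵢ G
≤ᵢ-trans E≤F F≤G = record
  { embed     = F≤G.embed ∘ E≤F.embed
  ; injective = E≤F.injective ∘ F≤G.injective
  ; induced   = mk⇔
      (Equivalence.to F≤G.induced ∘ Equivalence.to E≤F.induced)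
      (Equivalence.from E≤F.induced ∘ Equivalence.from F≤G.induced)
  }
  where
  module E≤F = _≤ᵢ_ E≤F
  module F≤G = _≤ᵢ_ F≤G

reflects-⇔ : ∀ {A B : Set} {b} → Reflects A b → Reflects B b → A ⇔ B
reflects-⇔ (ofʸ a)  (ofʸ b)  = mk⇔ (const b) (const a)
reflects-⇔ (ofⁿ ¬a) (ofⁿ ¬b) =
  mk⇔ (λ a → contradiction a ¬a) (λ b → contradiction b ¬b)

module P₄ = Graph (path 4)

P₄-isolateFree : IsolateFree (path 4)
P₄-isolateFree = from-yes (all? λ v → any? λ w → P₄.Adj? v w)

-- Vertices with equal images under an adjacency-preserving and -reflecting map have the same
-- neighbours, so this yields injectivity in `inducedP₄`.
P₄-twinFree : ∀ i j → (∀ k → P₄.Adj i k → P₄.Adj j k) →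
              (∀ k → P₄.Adj j k → P₄.Adj i k) → i ≡ j
P₄-twinFree = from-yes (all? λ i → all? λ j →
  (all? λ k → P₄.Adj? i k →-dec P₄.Adj? j k) →-dec
  ((all? λ k → P₄.Adj? j k →-dec P₄.Adj? i k) →-dec (i ≟ j)))

γₜg′[P₄]≢γₜ[P₄] : γₜg′ (path 4) ≢ γₜ (path 4)
γₜg′[P₄]≢γₜ[P₄] ()

perfect⇒cograph : ∀ {G} → γₜg′-Perfect G → Cograph G
perfect⇒cograph perfect P₄≤G =
  γₜg′[P₄]≢γₜ[P₄] (perfect (path 4) P₄≤G P₄-isolateFree)

module _ (G : Graph) where
  open Graph G

  inducedP₄ : ∀ {a b c d} → Adj a b → Adj b c → Adj c d →
              ¬ Adj a c → ¬ Adj b d → ¬ Adj a d → path 4 ≤ᵢ G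
  inducedP₄ {a} {b} {c} {d} ab bc cd ac bd ad = record
    { embed     = embed
    ; injective = λ {i} {j} eq → P₄-twinFree i j (twin eq) (twin (sym eq))
    ; induced   = induced
    }
    where
    embed : P₄.Vertex → Vertex
    embed = lookup (a ∷ b ∷ c ∷ d ∷ [])

    -- With the decision as index, each entry computes to a concrete Boolean and asks for one edge
    -- or one non-edge.
    table : ∀ i j → Reflects (Adj (embed i) (embed j)) (does (P₄.Adj? i j))
    table zero zero = ofⁿ (irrefl refl)
    table zero (suc zero) = ofʸ ab
    table zero (suc (suc zero)) = ofⁿ ac
    table zero (suc (suc (suc zero))) = ofⁿ ad
    table (suc zero) zero = ofʸ (symm ab)
    table (suc zero) (suc zero) = ofⁿ (irrefl refl)
    table (suc zero) (suc (suc zero)) = ofʸ bc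
    table (suc zero) (suc (suc (suc zero))) = ofⁿ bd
    table (suc (suc zero)) zero = ofⁿ (ac ∘ symm)
    table (suc (suc zero)) (suc zero) = ofʸ (symm bc)
    table (suc (suc zero)) (suc (suc zero)) = ofⁿ (irrefl refl)
    table (suc (suc zero)) (suc (suc (suc zero))) = ofʸ cd
    table (suc (suc (suc zero))) zero = ofⁿ (ad ∘ symm)
    table (suc (suc (suc zero))) (suc zero) = ofⁿ (bd ∘ symm)
    table (suc (suc (suc zero))) (suc (suc zero)) = ofʸ (symm cd)
    table (suc (suc (suc zero))) (suc (suc (suc zero))) = ofⁿ (irrefl refl)

    induced : ∀ {i j} → P₄.Adj i j ⇔ Adj (embed i) (embed j)
    induced {i} {j} = reflects-⇔ (proof (P₄.Adj? i j)) (table i j)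

    twin : ∀ {i j} → embed i ≡ embed j → ∀ k → P₄.Adj i k → P₄.Adj j k
    twin eq k = Equivalence.from induced
              ∘ subst (λ v → Adj v (embed k)) eq
              ∘ Equivalence.to induced

-- Neighbourhoods in a cograph.

module Partner (G : Graph) (cograph : Cograph G) where
  open Graph G

  P₄-free : ∀ {a b c d} → Adj a b → Adj b c → Adj c d →
            ¬ Adj a c → ¬ Adj b d → Adj a d
  P₄-free {a} {d = d} ab bc cd ac bd = decidable-stable (Adj? a d)
    λ ad → cograph (inducedP₄ G ab bc cd ac bd ad)

  -- The preorder, on neighbours of `v`, of inclusion between the parts of N(w) and N(a) outside
  -- N(v).
  Covers : Vertex → Vertex → Vertex → Set
  Covers v a w = ∀ u → Adj w u → Adj v u ⊎ Adj a u

  covers? : ∀ v a w u → Dec (Adj w u → Adj v u ⊎ Adj a u)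
  covers? v a w u = Adj? w u →-dec (Adj? v u ⊎-dec Adj? a u)

  -- If, among v, a and w, u is adjacent only to w and u′ only to a, then one of
  -- u w v a, u w a u′ and u u′ a v is an induced P₄.
  covers-total : ∀ {v a w} → Adj v a → Adj v w → Covers v a w ⊎ Covers v w a
  covers-total {v} {a} {w} va vw with all? (covers? v a w)
  ... | yes covers = inj₁ covers
  ... | no ¬covers with ¬∀⟶∃¬ _ _ (covers? v a w) ¬covers
  ... | u , ¬wu⇒ = inj₂ covers
    where
    wu : Adj w u
    wu = decidable-stable (Adj? w u) λ ¬wu → ¬wu⇒ λ wu → contradiction wu ¬wu
    ¬vu : ¬ Adj v u
    ¬vu vu = ¬wu⇒ (const (inj₁ vu))
    ¬au : ¬ Adj a u
    ¬au au = ¬wu⇒ (const (inj₂ au))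

    covers : Covers v w a
    covers u′ au′ with Adj? v u′ | Adj? w u′
    ... | yes vu′ | _       = inj₁ vu′
    ... | no _    | yes wu′ = inj₂ wu′
    ... | no ¬vu′ | no ¬wu′ = contradiction vu ¬vu
      where
      wa : Adj w a
      wa = decidable-stable (Adj? w a) λ ¬wa →
        ¬au (symm (P₄-free (symm wu) (symm vw) va (¬vu ∘ symm) ¬wa))
      uu′ : Adj u u′
      uu′ = P₄-free (symm wu) wa au′ (¬au ∘ symm) ¬wu′
      vu : Adj v u
      vu = P₄-free va au′ (symm uu′) ¬vu′ ¬au

  greatest : ∀ {v a₀} → Adj v a₀ → ∀ ws →
             ∃[ a ] (Adj v a × All (λ w → Adj v w → Covers v a w) ws)
  greatest {a₀ = a₀} va₀ [] = a₀ , va₀ , []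
  greatest {v} va₀ (w ∷ ws) with greatest va₀ ws | Adj? v w
  ... | a , va , ≲a | no ¬vw = a , va , (λ vw → contradiction vw ¬vw) ∷ ≲a
  ... | a , va , ≲a | yes vw with covers-total va vw
  ... | inj₁ w≲a = a , va , const w≲a ∷ ≲a
  -- Transitivity: what `a` covers lies in N(v) or N(a), and `w` covers N(a).
  ... | inj₂ a≲w = w , vw , (λ _ u → inj₂) ∷ All.map
        (λ x≲a vx u xu → [ inj₁ , a≲w u ]′ (x≲a vx u xu)) ≲a

  -- Maximality of `v′` handles edges leaving N(v). For x in N(v′) but not in N(v), an edge xy
  -- leaving both sets would make v v′ x y an induced P₄. Since vv′ is an edge, the union of N(v)
  -- and N(v′) is the component of `v`.
  partner : ∀ {v a₀} → Adj v a₀ → ∃[ v′ ] (Adj v v′ ×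
            (∀ {x y} → Adj v x ⊎ Adj v′ x → Adj x y → Adj v y ⊎ Adj v′ y))
  partner {v} va₀ with greatest va₀ (allFin order)
  ... | v′ , vv′ , ≲v′ = v′ , vv′ , closed
    where
    closed : ∀ {x y} → Adj v x ⊎ Adj v′ x → Adj x y → Adj v y ⊎ Adj v′ y
    closed {x} {y} (inj₁ vx) xy = All.lookup ≲v′ (∈-allFin x) vx y xy
    closed {x} {y} (inj₂ v′x) xy with Adj? v x
    ... | yes vx = closed (inj₁ vx) xy
    ... | no ¬vx with Adj? v′ y
    ... | yes v′y = inj₂ v′y
    ... | no ¬v′y = inj₁ (P₄-free vv′ v′x xy ¬vx ¬v′y)

-- Sizes of subsets and values of optimal choices.

∣p∪⁅x⁆∣≤1+∣p∣ : ∀ {n} (p : Subset n) x → ∣ p ∪ ⁅ x ⁆ ∣ ≤ suc ∣ p ∣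
∣p∪⁅x⁆∣≤1+∣p∣ (true  ∷ p) zero    rewrite ∪-identityʳ p = n≤1+n _
∣p∪⁅x⁆∣≤1+∣p∣ (false ∷ p) zero    rewrite ∪-identityʳ p = ≤-refl
∣p∪⁅x⁆∣≤1+∣p∣ (true  ∷ p) (suc x) = s≤s (∣p∪⁅x⁆∣≤1+∣p∣ p x)
∣p∪⁅x⁆∣≤1+∣p∣ (false ∷ p) (suc x) = ∣p∪⁅x⁆∣≤1+∣p∣ p x

∈-subsets : ∀ {n} (p : Subset n) → p ∈ˡ subsets n
∈-subsets []          = here refl
∈-subsets (true  ∷ p) = ∈-++⁺ˡ (∈-map⁺ (true ∷_) (∈-subsets p))
∈-subsets (false ∷ p) =
  ∈-++⁺ʳ (map (true ∷_) (subsets _)) (∈-map⁺ (false ∷_) (∈-subsets p))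

module _ {A : Set} {f : A → ℕ} where

  -- The strict inequality pays for the move itself.
  optimum-staller-≤ : ∀ {m vs} → All (λ v → f v < m) vs →
                      optimum staller f vs ≤ m
  optimum-staller-≤ []               = z≤n
  optimum-staller-≤ (s≤s fv≤m ∷ fvs) =
    s≤s (max≤v⁺ fv≤m (All.map⁺ (All.map (λ { (s≤s le) → le }) fvs)))

  optimum-dominator-≤ : ∀ {v vs} → v ∈ˡ vs → optimum dominator f vs ≤ suc (f v)
  optimum-dominator-≤ {vs = v ∷ vs} (here refl) =
    s≤s (min≤⊤ (f v) (map f vs))
  optimum-dominator-≤ {vs = v ∷ vs} (there v∈vs) =
    s≤s (All.lookup (min≤xs (f v) (map f vs)) (∈-map⁺ f v∈vs))

  best-attained : ∀ p v vs → ∃[ w ] (w ∈ˡ v ∷ vs × best p (f v) (map f vs) ≡ f w)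
  best-attained p v vs = [ (λ eq → v , here refl , eq)
                         , (λ ∈map → let w , w∈vs , eq = ∈-map⁻ f ∈map in
                                     w , there w∈vs , eq)
                         ]′ (best-sel p)
    where
    best-sel : ∀ p → best p (f v) (map f vs) ≡ f v ⊎
                     best p (f v) (map f vs) ∈ˡ map f vs
    best-sel dominator = argmin-sel id (f v) (map f vs)
    best-sel staller   = argmax-sel id (f v) (map f vs)

  optimum-attained : ∀ p {v vs} → v ∈ˡ vs →
                     ∃[ w ] (w ∈ˡ vs × optimum p f vs ≡ suc (f w))
  optimum-attained p {vs = v ∷ vs} _ =
    let w , w∈ , eq = best-attained p v vs in w , w∈ , cong suc eq

-- Bounds on the length of the game.

module Bounds (G : Graph) (isolateFree : IsolateFree G) where
  open Graph G

  dominated-∪ˡ : ∀ {S v u} → TotallyDominated G S u →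
                 TotallyDominated G (S ∪ ⁅ v ⁆) u
  dominated-∪ˡ {v = v} (w , w∈S , wu) = w , p⊆p∪q ⁅ v ⁆ w∈S , wu

  dominated-∪ʳ : ∀ {S v u} → Adj v u → TotallyDominated G (S ∪ ⁅ v ⁆) u
  dominated-∪ʳ {v = v} vu = v , x∈p∪q⁺ (inj₂ (x∈⁅x⁆ v)) , vu

  dominated-∪⁻ : ∀ {S v u} → TotallyDominated G (S ∪ ⁅ v ⁆) u →
                 TotallyDominated G S u ⊎ Adj v u
  dominated-∪⁻ {S} {v} (w , w∈ , wu) with x∈p∪q⁻ S ⁅ v ⁆ w∈
  ... | inj₁ w∈S = inj₁ (w , w∈S , wu)
  ... | inj₂ w∈v with x∈⁅y⁆⇒x≡y v w∈v
  ... | refl = inj₂ wu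

  totalDominatingSets : List (Subset order)
  totalDominatingSets = filter (totalDominatingSet? G) (subsets order)

  γₜ-≤ : ∀ {S} → TotalDominatingSet G S → γₜ G ≤ ∣ S ∣
  γₜ-≤ {S} tds = min≤v⁺ order _ (inj₂ (lose
    (∈-map⁺ ∣_∣ (∈-filter⁺ (totalDominatingSet? G) (∈-subsets S) tds)) ≤-refl))

  ≤-γₜ : ∀ {m} → (∀ S → TotalDominatingSet G S → m ≤ ∣ S ∣) → m ≤ γₜ G
  ≤-γₜ bound = v≤min⁺
    -- The default value `order` of the minimum must be bounded as well; the full vertex set does
    -- this.
    (≤-trans (bound ⊤ tds-⊤) (∣p∣≤n (⊤ {order})))
    (All.map⁺ (All.map (λ {S} → bound S)
      (All.all-filter (totalDominatingSet? G) (subsets order))))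
    where
    tds-⊤ : TotalDominatingSet G ⊤
    tds-⊤ u = let w , uw = isolateFree u in w , ∈⊤ , symm uw

  legal⇒∈ : ∀ {S v} → LegalMove G S v → v ∈ˡ legalMoves G S
  legal⇒∈ {S} {v} = ∈-filter⁺ (legalMove? G S) (∈-allFin v)

  allLegal : ∀ S → All (LegalMove G S) (legalMoves G S)
  allLegal S = All.all-filter (legalMove? G S) (allFin order)

  legal⇒∣∪∣ : ∀ {S v} → LegalMove G S v → suc ∣ S ∣ ≤ ∣ S ∪ ⁅ v ⁆ ∣
  legal⇒∣∪∣ {S} {v} (u , vu , ¬dom) = p⊂q⇒∣p∣<∣q∣
    (p⊆p∪q ⁅ v ⁆ , v , x∈p∪q⁺ (inj₂ (x∈⁅x⁆ v)) , λ v∈S → ¬dom (v , v∈S , vu))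

  -- An undominated vertex has a neighbour, which is a legal move, so play continues until the set
  -- is total dominating. The recursion follows one optimal play, each move adding at most one
  -- vertex; the bound on `order` ensures that the cut-off cannot come too early.
  γₜ≤moves : ∀ k p S → order ≤ k + ∣ S ∣ →
             γₜ G ≤ ∣ S ∣ + movesWithin G k p S
  γₜ≤moves zero p S full = begin
    γₜ G       ≤⟨ min≤⊤ order (map ∣_∣ totalDominatingSets) ⟩
    order      ≤⟨ full ⟩
    ∣ S ∣      ≡⟨ +-identityʳ ∣ S ∣ ⟨
    ∣ S ∣ + 0  ∎
    where open ≤-Reasoning
  γₜ≤moves (suc k) p S bound with totalDominatingSet? G S
  ... | yes tds = ≤-trans (γₜ-≤ tds) (m≤m+n ∣ S ∣ _)
  ... | no ¬tds with ¬∀⟶∃¬ _ _ (totallyDominated? G S) ¬tds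
  ... | u , ¬dom with isolateFree u
  ... | w , uw with optimum-attained p (legal⇒∈ (u , symm uw , ¬dom))
  ... | v , v∈ , eq = begin
    γₜ G                               ≤⟨ γₜ≤moves k (opponent p) (S ∪ ⁅ v ⁆) bound′ ⟩
    ∣ S ∪ ⁅ v ⁆ ∣ + m                  ≤⟨ +-monoˡ-≤ m (∣p∪⁅x⁆∣≤1+∣p∣ S v) ⟩
    suc ∣ S ∣ + m                      ≡⟨ +-suc ∣ S ∣ m ⟨
    ∣ S ∣ + suc m                      ≡⟨ cong (∣ S ∣ +_) eq ⟨
    ∣ S ∣ + movesWithin G (suc k) p S  ∎
    where
    open ≤-Reasoning
    m : ℕ
    m = movesWithin G k (opponent p) (S ∪ ⁅ v ⁆)

    bound′ : order ≤ k + ∣ S ∪ ⁅ v ⁆ ∣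
    bound′ = begin
      order              ≤⟨ bound ⟩
      suc k + ∣ S ∣      ≡⟨ +-suc k ∣ S ∣ ⟨
      k + suc ∣ S ∣      ≤⟨ +-monoʳ-≤ k (legal⇒∣∪∣ (All.lookup (allLegal S) v∈)) ⟩
      k + ∣ S ∪ ⁅ v ⁆ ∣  ∎

  -- The dominated vertices form a union of components.
  Closed : Subset order → Set
  Closed S = ∀ {x y} → TotallyDominated G S x → Adj x y → TotallyDominated G S y

  -- `R` serves as the unspent part of a total dominating set fixed at the start; its size bounds
  -- the moves still to come.
  Completes : Subset order → Subset order → Set
  Completes R S = ∀ u → ¬ TotallyDominated G S u → ∃[ d ] (d ∈ R × Adj d u)

  module _ (cograph : Cograph G) where
    open Partner G cograph

    Reply : Subset order → Subset order → Vertex → Set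
    Reply R S v = ∃[ v′ ] ∃[ R′ ] (LegalMove G (S ∪ ⁅ v ⁆) v′ ×
      Closed ((S ∪ ⁅ v ⁆) ∪ ⁅ v′ ⁆) × Completes R′ ((S ∪ ⁅ v ⁆) ∪ ⁅ v′ ⁆) ×
      suc (suc ∣ R′ ∣) ≤ ∣ R ∣)

    reply : ∀ {R S v} → Closed S → Completes R S → LegalMove G S v → Reply R S v
    reply {R} {S} {v} closed completes (u , vu , ¬dom-u)
      with partner vu
    ... | v′ , vv′ , pairClosed
      -- If `v` or `d₁` were dominated, closedness would carry domination along edges to `u`.
      with completes v (λ dom → ¬dom-u (closed dom vu))
    ... | d₁ , d₁∈R , d₁v
      with completes d₁ (λ dom → ¬dom-u (closed (closed dom d₁v) vu))
    ... | d₂ , d₂∈R , d₂d₁ =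
      v′ , R′ , legal′ , closed′ , completes′ , 2+∣R′∣≤∣R∣
      where
      S′ : Subset order
      S′ = (S ∪ ⁅ v ⁆) ∪ ⁅ v′ ⁆

      R′ : Subset order
      R′ = (R - d₁) - d₂

      pair⇒dominated : ∀ {x} → Adj v x ⊎ Adj v′ x → TotallyDominated G S′ x
      pair⇒dominated =
        [ dominated-∪ˡ ∘ dominated-∪ʳ , dominated-∪ʳ ]′

      closed′ : Closed S′
      closed′ dom xy with dominated-∪⁻ dom
      ... | inj₂ v′x = pair⇒dominated (pairClosed (inj₂ v′x) xy)
      ... | inj₁ dom′ with dominated-∪⁻ dom′
      ... | inj₂ vx = pair⇒dominated (pairClosed (inj₁ vx) xy)
      ... | inj₁ dom″ = dominated-∪ˡ (dominated-∪ˡ (closed dom″ xy))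

      dominated-d₁ : TotallyDominated G S′ d₁
      dominated-d₁ = pair⇒dominated (inj₁ (symm d₁v))

      completes′ : Completes R′ S′
      completes′ x ¬dom with completes x (¬dom ∘ dominated-∪ˡ ∘ dominated-∪ˡ)
      -- All neighbours of `d₁` and `d₂` are now dominated, so `d` is neither of them.
      ... | d , d∈R , dx = d , x∈p∧x≢y⇒x∈p-y (x∈p∧x≢y⇒x∈p-y d∈R
        (λ { refl → ¬dom (closed′ dominated-d₁ dx) }))
        (λ { refl → ¬dom (closed′ (closed′ dominated-d₁ (symm d₂d₁)) dx) }) , dx

      2+∣R′∣≤∣R∣ : suc (suc ∣ R′ ∣) ≤ ∣ R ∣
      2+∣R′∣≤∣R∣ = ≤-trans
        (s≤s (x∈p⇒∣p-x∣<∣p∣ (x∈p∧x≢y⇒x∈p-y d₂∈R λ d₂≡d₁ → irrefl d₂≡d₁ d₂d₁)))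
        (x∈p⇒∣p-x∣<∣p∣ d₁∈R)

      legal′ : LegalMove G (S ∪ ⁅ v ⁆) v′
      -- The vertex newly dominated by `v′` is `v` itself.
      legal′ = v , symm vv′ , [ (λ dom → ¬dom-u (closed dom vu)) , irrefl refl ]′
                              ∘ dominated-∪⁻

    -- Each round spends two moves and shrinks `R` by at least two; Dominator's optimum is at most
    -- the value of the given reply.
    moves≤ : ∀ k {R S} → Closed S → Completes R S →
             movesWithin G k staller S ≤ ∣ R ∣
    moves< : ∀ k {R S v} → Reply R S v →
             movesWithin G k dominator (S ∪ ⁅ v ⁆) < ∣ R ∣

    moves≤ zero closed completes = z≤n
    moves≤ (suc k) {R} closed completes = optimum-staller-≤
      (All.map (λ legal → moves< k {R} (reply closed completes legal)) (allLegal _))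

    -- The cut-off may fall between Staller's move and the reply; then `R` need only be nonempty.
    moves< zero (_ , _ , _ , _ , _ , 2+∣R′∣≤∣R∣) =
      ≤-trans (s≤s z≤n) 2+∣R′∣≤∣R∣
    moves< (suc k) (_ , _ , legal , closed , completes , 2+∣R′∣≤∣R∣) = ≤-trans
      (s≤s (≤-trans (optimum-dominator-≤ (legal⇒∈ legal))
        (s≤s (moves≤ k closed completes))))
      2+∣R′∣≤∣R∣

  cograph⇒γₜg′≡γₜ : Cograph G → γₜg′ G ≡ γₜ G
  cograph⇒γₜg′≡γₜ cograph = ≤-antisym
    -- Here `R` is an arbitrary total dominating set; the initial position dominates nothing and is
    -- vacuously closed.
    (≤-γₜ λ S tds → moves≤ cograph order {S} {∅}
      (λ (_ , w∈∅ , _) → contradiction w∈∅ ∉⊥)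
      (λ u _ → tds u))
    (≤-trans (γₜ≤moves order staller ∅ (m≤m+n order _))
      (≤-reflexive (cong (_+ γₜg′ G) (∣⊥∣≡0 order))))

proposition5p3 : (G : Graph) → IsolateFree G → (γₜg′-Perfect G ⇔ Cograph G)
proposition5p3 G _ = mk⇔ (perfect⇒cograph {G}) λ cograph F F≤G isolateFree →
  Bounds.cograph⇒γₜg′≡γₜ F isolateFree (λ P₄≤F → cograph (≤ᵢ-trans P₄≤F F≤G))
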